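{- For all positive integers $m$ and $n$, $$\sum_{k=1}^nH_k\sum_{j=m}^{n-k+1}\binom{n-k}{j-1}\frac{s(j,m)}{j!}=\frac{1}{m!}H_{n+1}(m+1).$$ In particular, $\sum_{k=1}^n\frac{H_k}{n-k+1}=H_{n+1}^2-H_{n+1}^{(2)}$.
   Context: For integers $m\ge 1$, $n\ge 0$, the multiple harmonic-like numbers are $H_n(m)=\sum_{1\le k_1+k_2+\cdots+k_m\le n}\frac{1}{k_1k_2\cdots k_m}$ (sum over positive integers $k_1,\dots,k_m$), with $H_n(0)=1$ for $n\ge 0$ and $H_0(m)=0$ for $m\ge1$. $H_n=\sum_{k=1}^n\frac1k$, $H_n^{(2)}=\sum_{k=1}^n\frac1{k^2}$. The (signed) Stirling numbers of the first kind $s(n,k)$ are defined by $\sum_{n\ge k}s(n,k)\frac{z^n}{n!}=\frac{\ln^k(1+z)}{k!}$, with $s(n,k)=0$ for $n<k$. -}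

module Defs where

open import Data.Nat.Base using (ℕ; zero; suc; _∸_; NonZero; _≤_; _<_; s≤s; _!)
import Data.Nat.Base as ℕ
import Data.Nat.Properties as ℕₚ
open import Data.Integer.Base using (+_; -1ℤ)
import Data.Integer.Base as ℤ
import Data.Integer.Properties as ℤₚ
open import Data.Rational.Base using (ℚ; 0ℚ; 1ℚ; _+_; _*_; _/_; toℚᵘ)
import Data.Rational.Properties as ℚₚ
import Data.Rational.Unnormalised.Base as ℚᵘ
import Data.Rational.Unnormalised.Properties as ℚᵘₚ
open import Data.Fin.Base using (Fin; toℕ)
open import Data.List.Base using (List; []; _∷_; map; filter; foldr; upTo; allFin; cartesianProductWith)
import Data.Vec.Base as Vec
open import Data.Vec.Base using (Vec; []; _∷_)
open import Data.List.Relation.Unary.All using (All; []; _∷_)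
open import Data.List.Relation.Unary.All.Properties using (applyUpTo⁺₁)
open import Function.Base using (id)
open import Data.Product.Base using (_×_)
open import Relation.Nullary.Decidable using (Dec; _×-dec_)
open import Relation.Binary.PropositionalEquality using (_≡_; refl; sym; trans; cong; cong₂; module ≡-Reasoning)

fromℕ : ℕ → ℚ
fromℕ n = + n / 1

1/_! : ℕ → ℚ
1/ n ! = _/_ (+ 1) (n !) {{n ℕₚ.!≢0}}

∑ : {A : Set} → List A → (A → ℚ) → ℚ
∑ xs f = foldr _+_ 0ℚ (map f xs)

-- The integers a, a+1, …, b; empty when b < a.
_⋯_ : ℕ → ℕ → List ℕ
a ⋯ b = map (a ℕ.+_) (upTo (suc b ∸ a))

infix 5 _⋯_

infixr 5 ∑-syntax
∑-syntax : {A : Set} → List A → (A → ℚ) → ℚ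
∑-syntax = ∑
syntax ∑-syntax xs (λ x → e) = ∑[ x ∈ xs ] e

-- In the next two definitions the summation index is k = suc i, 1 ≤ k ≤ n.

H : ℕ → ℚ
H n = ∑[ i ∈ upTo n ] + 1 / suc i

H⁽²⁾ : ℕ → ℚ
H⁽²⁾ n = ∑[ i ∈ upTo n ] + 1 / (suc i ℕ.* suc i)

tuples : (m n : ℕ) → List (Vec (Fin n) m)
tuples zero    n = [] ∷ []
tuples (suc m) n = cartesianProductWith _∷_ (allFin n) (tuples m n)

-- A vector over Fin n encodes a tuple (k₁,…,kₘ) with 1 ≤ kᵢ ≤ n, the entry i
-- standing for suc (toℕ i).
values : ∀ {m n} → Vec (Fin n) m → Vec ℕ m
values = Vec.map (λ i → suc (toℕ i))

product : ∀ {m} → Vec ℕ m → ℕ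
product = Vec.foldr _ ℕ._*_ 1

product≢0 : ∀ {m n} (ks : Vec (Fin n) m) → NonZero (product (values ks))
product≢0 []       = _
product≢0 (i ∷ ks) = ℕₚ.m*n≢0 (suc (toℕ i)) (product (values ks)) {{_}} {{product≢0 ks}}

1/product : ∀ {m n} → Vec (Fin n) m → ℚ
1/product ks = _/_ (+ 1) (product (values ks)) {{product≢0 ks}}

InRange : ∀ {m n} → Vec (Fin n) m → Set
InRange {n = n} ks = 1 ≤ Vec.sum (values ks) × Vec.sum (values ks) ≤ n

inRange? : ∀ {m n} (ks : Vec (Fin n) m) → Dec (InRange ks)
inRange? {n = n} ks = (1 ℕₚ.≤? Vec.sum (values ks)) ×-dec (Vec.sum (values ks) ℕₚ.≤? n)

-- Hₙ(m) is written H[ n , m ].  Restricting each kᵢ to 1 ≤ kᵢ ≤ n loses nothing,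
-- since k₁ + ⋯ + kₘ ≤ n.
H[_,_] : ℕ → ℕ → ℚ
H[ n , zero  ] = 1ℚ
H[ n , suc m ] = ∑ (filter inRange? (tuples (suc m) n)) 1/product

-- Formal power series over ℚ: f n is the coefficient of zⁿ.
Series : Set
Series = ℕ → ℚ

one : Series
one zero    = 1ℚ
one (suc _) = 0ℚ

_⊛_ : Series → Series → Series
(f ⊛ g) n = ∑[ i ∈ upTo (suc n) ] f i * g (n ∸ i)

_^ˢ_ : Series → ℕ → Series
f ^ˢ zero  = one
f ^ˢ suc k = f ⊛ (f ^ˢ k)

-- ln(1+z) = ∑_{n ≥ 1} (-1)ⁿ⁻¹ zⁿ / n
ln[1+z] : Series
ln[1+z] zero    = 0ℚ
ln[1+z] (suc n) = (-1ℤ ℤ.^ n) / suc n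

-- The signed Stirling numbers of the first kind, read off from their exponential
-- generating function: s(n,k) = n! · [zⁿ] (ln(1+z)ᵏ / k!).
s : ℕ → ℕ → ℚ
s n k = fromℕ (n !) * ((ln[1+z] ^ˢ k) n * 1/ k !)

private
  fromℕ*1/ : ∀ n .{{_ : NonZero n}} → fromℕ n * (+ 1 / n) ≡ 1ℚ
  fromℕ*1/ (suc n) = ℚₚ.toℚᵘ-injective (begin
    toℚᵘ (fromℕ (suc n) * (+ 1 / suc n))
      ≈⟨ ℚₚ.toℚᵘ-homo-* (fromℕ (suc n)) (+ 1 / suc n) ⟩
    toℚᵘ (fromℕ (suc n)) ℚᵘ.* toℚᵘ (+ 1 / suc n)
      ≈⟨ ℚᵘₚ.*-cong (ℚₚ.toℚᵘ-fromℚᵘ (ℚᵘ.mkℚᵘ (+ suc n) 0)) (ℚₚ.toℚᵘ-fromℚᵘ (ℚᵘ.mkℚᵘ (+ 1) n)) ⟩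
    ℚᵘ.mkℚᵘ (+ suc n) 0 ℚᵘ.* ℚᵘ.mkℚᵘ (+ 1) n
      ≈⟨ ℚᵘ.*≡* (trans (ℤₚ.*-identityʳ _) (trans (ℤₚ.*-identityʳ (+ suc n))
           (trans (cong +_ (sym (ℕₚ.+-identityʳ (suc n)))) (sym (ℤₚ.*-identityˡ _))))) ⟩
    toℚᵘ 1ℚ ∎)
    where open ℚᵘₚ.≃-Reasoning

  ∑-zero : {A : Set} {xs : List A} {f : A → ℚ} → All (λ x → f x ≡ 0ℚ) xs → ∑ xs f ≡ 0ℚ
  ∑-zero []           = refl
  ∑-zero (fx≡0 ∷ all) = cong₂ _+_ fx≡0 (∑-zero all)

  ^ˢ-vanish : ∀ n k → n < k → (ln[1+z] ^ˢ k) n ≡ 0ℚ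
  ^ˢ-vanish n (suc k) (s≤s n≤k) = ∑-zero (applyUpTo⁺₁ id (suc n) (term n n≤k))
    where
    term : ∀ n → n ≤ k → ∀ {i} → i < suc n → ln[1+z] i * (ln[1+z] ^ˢ k) (n ∸ i) ≡ 0ℚ
    term n       n≤k {zero}  _ = ℚₚ.*-zeroˡ ((ln[1+z] ^ˢ k) n)
    term (suc n) n≤k {suc i} _ =
      trans (cong (ln[1+z] (suc i) *_) (^ˢ-vanish (n ∸ i) k (ℕₚ.≤-trans (s≤s (ℕₚ.m∸n≤m n i)) n≤k)))
            (ℚₚ.*-zeroʳ (ln[1+z] (suc i)))
    term zero    n≤k {suc i} (s≤s ())

s-egf : ∀ n k → s n k * 1/ n ! ≡ (ln[1+z] ^ˢ k) n * 1/ k !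
s-egf n k = begin
  fromℕ (n !) * c * 1/ n !    ≡⟨ cong (_* 1/ n !) (ℚₚ.*-comm (fromℕ (n !)) c) ⟩
  c * fromℕ (n !) * 1/ n !    ≡⟨ ℚₚ.*-assoc c (fromℕ (n !)) (1/ n !) ⟩
  c * (fromℕ (n !) * 1/ n !)  ≡⟨ cong (c *_) (fromℕ*1/ (n !) {{n ℕₚ.!≢0}}) ⟩
  c * 1ℚ                      ≡⟨ ℚₚ.*-identityʳ c ⟩
  c                           ∎
  where
  open ≡-Reasoning
  c = (ln[1+z] ^ˢ k) n * 1/ k !

s-vanish : ∀ n k → n < k → s n k ≡ 0ℚ
s-vanish n k n<k = begin
  fromℕ (n !) * ((ln[1+z] ^ˢ k) n * 1/ k !)  ≡⟨ cong (λ c → fromℕ (n !) * (c * 1/ k !)) (^ˢ-vanish n k n<k) ⟩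
  fromℕ (n !) * (0ℚ * 1/ k !)                ≡⟨ cong (fromℕ (n !) *_) (ℚₚ.*-zeroˡ (1/ k !)) ⟩
  fromℕ (n !) * 0ℚ                           ≡⟨ ℚₚ.*-zeroʳ (fromℕ (n !)) ⟩
  0ℚ                                         ∎
  where open ≡-Reasoning

{-# OPTIONS --safe #-}
module Submission where

-- Let L = -ln(1-x) = ∑_{k ≥ 1} xᵏ/k.  Then H_n(m) = [xⁿ] Lᵐ/(1-x), and in particular
-- ∑ H_k xᵏ = L/(1-x).  The sum over j is a binomial transform: since
-- ∑_N C(N,j-1) xᴺ⁺¹ = (x/(1-x))ʲ, it is the coefficient of xᴺ⁺¹, N = n-k, in
-- lnᵐ(1+z)/m! at z = x/(1-x), i.e. in Lᵐ/m!.  Hence the left-hand side is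
-- [xⁿ⁺¹] (L/(1-x)) · Lᵐ/m! = H_{n+1}(m+1)/m!.  For m = 1 the second formula follows from
-- [xⁿ⁺¹] L² = 2 H_n/(n+1), the increment of H_n² - H_n⁽²⁾.

open import Defs
open import Data.Nat.Base using (ℕ; zero; suc; _∸_; _≤_; _<_; z≤n; s≤s; _≤ᵇ_; NonZero)
import Data.Nat.Base as ℕ
import Data.Nat.Properties as ℕₚ
open import Data.Nat.Combinatorics using (_C_; nCk+nC[k+1]≡[n+1]C[k+1]; k>n⇒nCk≡0)
open import Data.Integer.Base using (+_; -1ℤ)
import Data.Integer.Base as ℤ
import Data.Integer.Properties as ℤₚ
open import Data.Rational.Base using (ℚ; 0ℚ; 1ℚ; _+_; _*_; _-_; -_; _/_; fromℚᵘ)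
open import Data.Rational.Properties
open import Data.Rational.Solver using (module +-*-Solver)
import Data.Rational.Unnormalised.Base as ℚᵘ
import Data.Rational.Unnormalised.Properties as ℚᵘₚ
open import Data.Bool.Base using (Bool; true; false; if_then_else_)
open import Data.Fin.Base using (Fin; toℕ)
import Data.Fin.Base as Fin
open import Data.List.Base using (List; []; _∷_; _++_; map; filter; upTo; applyUpTo; tabulate; cartesianProductWith)
open import Data.List.Properties using (map-applyUpTo)
import Data.Vec.Base as Vec
open import Data.Vec.Base using (Vec; []; _∷_)
open import Data.Product.Base using (_×_; _,_)
open import Function.Base using (_∘_; id)
open import Relation.Nullary.Decidable using (does)
open import Relation.Unary using (Decidable)
open import Relation.Binary.PropositionalEquality using (_≡_; _≗_; refl; sym; trans; cong; cong₂; module ≡-Reasoning)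
open ≡-Reasoning
open +-*-Solver using (solve; _:+_; _:*_; _:-_; _:=_; con)

-- Fractions

-- Normalisation hides the numerators, so the equation is checked after `toℚᵘ`, where both sides are
-- equivalent to the unnormalised sum `p ℚᵘ.+ q`.
fromℚᵘ-homo-+ : ∀ p q → fromℚᵘ (p ℚᵘ.+ q) ≡ fromℚᵘ p + fromℚᵘ q
fromℚᵘ-homo-+ p q = toℚᵘ-injective
  (ℚᵘₚ.≃-trans (toℚᵘ-fromℚᵘ (p ℚᵘ.+ q))
  (ℚᵘₚ.≃-trans (ℚᵘₚ.≃-sym (ℚᵘₚ.+-cong (toℚᵘ-fromℚᵘ p) (toℚᵘ-fromℚᵘ q)))
  (ℚᵘₚ.≃-sym (toℚᵘ-homo-+ (fromℚᵘ p) (fromℚᵘ q)))))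

fromℚᵘ-homo-* : ∀ p q → fromℚᵘ (p ℚᵘ.* q) ≡ fromℚᵘ p * fromℚᵘ q
fromℚᵘ-homo-* p q = toℚᵘ-injective
  (ℚᵘₚ.≃-trans (toℚᵘ-fromℚᵘ (p ℚᵘ.* q))
  (ℚᵘₚ.≃-trans (ℚᵘₚ.≃-sym (ℚᵘₚ.*-cong (toℚᵘ-fromℚᵘ p) (toℚᵘ-fromℚᵘ q)))
  (ℚᵘₚ.≃-sym (toℚᵘ-homo-* (fromℚᵘ p) (fromℚᵘ q)))))

-- Once both denominators are successors, each quotient unfolds to `fromℚᵘ` of an explicit
-- unnormalised fraction.
/-homo-* : ∀ i j m n .{{_ : NonZero m}} .{{_ : NonZero n}} .{{_ : NonZero (m ℕ.* n)}} →
           (i ℤ.* j) / (m ℕ.* n) ≡ (i / m) * (j / n)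
/-homo-* i j (suc m) (suc n) = fromℚᵘ-homo-* (ℚᵘ.mkℚᵘ i m) (ℚᵘ.mkℚᵘ j n)

fromℕ-homo-+ : ∀ m n → fromℕ (m ℕ.+ n) ≡ fromℕ m + fromℕ n
fromℕ-homo-+ m n = trans
  (cong (_/ 1) (sym (cong₂ ℤ._+_ (ℤₚ.*-identityʳ (+ m)) (ℤₚ.*-identityʳ (+ n)))))
  (fromℚᵘ-homo-+ (ℚᵘ.mkℚᵘ (+ m) 0) (ℚᵘ.mkℚᵘ (+ n) 0))

fromℕ-suc : ∀ n → fromℕ (suc n) ≡ 1ℚ + fromℕ n
fromℕ-suc = fromℕ-homo-+ 1

suc*[i/suc] : ∀ n i → fromℕ (suc n) * (i / suc n) ≡ i / 1
suc*[i/suc] n i = trans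
  (sym (fromℚᵘ-homo-* (ℚᵘ.mkℚᵘ (+ suc n) 0) (ℚᵘ.mkℚᵘ i n)))
  (fromℚᵘ-cong {ℚᵘ.mkℚᵘ (+ suc n) 0 ℚᵘ.* ℚᵘ.mkℚᵘ i n} {ℚᵘ.mkℚᵘ i 0} (ℚᵘ.*≡* (begin
    + suc n ℤ.* i ℤ.* + 1      ≡⟨ ℤₚ.*-identityʳ _ ⟩
    + suc n ℤ.* i              ≡⟨ ℤₚ.*-comm (+ suc n) i ⟩
    i ℤ.* + suc n              ≡⟨ cong (λ k → i ℤ.* + k) (sym (ℕₚ.*-identityˡ (suc n))) ⟩
    i ℤ.* + (1 ℕ.* suc n)      ∎)))

1/suc : ℕ → ℚ
1/suc n = + 1 / suc n

-- Allows a coefficient to be identified after multiplication by n+1, the form that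
-- `binomial-absorption` delivers in `euler-ln`.
1/suc-unique : ∀ n q → fromℕ (suc n) * q ≡ 1ℚ → q ≡ 1/suc n
1/suc-unique n q eq = begin
  q                                  ≡⟨ sym (*-identityʳ q) ⟩
  q * 1ℚ                             ≡⟨ cong (q *_) (sym (suc*[i/suc] n (+ 1))) ⟩
  q * (fromℕ (suc n) * 1/suc n)      ≡⟨ solve 3 (λ a b c → a :* (b :* c) := (b :* a) :* c) refl q (fromℕ (suc n)) (1/suc n) ⟩
  (fromℕ (suc n) * q) * 1/suc n      ≡⟨ cong (_* 1/suc n) eq ⟩
  1ℚ * 1/suc n                       ≡⟨ *-identityˡ _ ⟩
  1/suc n                            ∎

-- This is 1/(xy) = (1/x + 1/y)/(x+y) with x = a+1, y = b+1. The left side is multiplied by (x+y)w =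
-- 1, and the cancellations xu = yv = 1 do the rest.
1/suc-partial-fractions : ∀ a b → 1/suc a * 1/suc b ≡ (1/suc a + 1/suc b) * 1/suc (suc (a ℕ.+ b))
1/suc-partial-fractions a b = begin
  u * v                             ≡⟨ sym (*-identityʳ _) ⟩
  u * v * 1ℚ                        ≡⟨ cong (u * v *_) (sym zw≡1) ⟩
  u * v * ((x + y) * w)             ≡⟨ solve 5 (λ x y u v w → u :* v :* ((x :+ y) :* w) := (u :* (y :* v) :+ v :* (x :* u)) :* w) refl x y u v w ⟩
  (u * (y * v) + v * (x * u)) * w   ≡⟨ cong₂ (λ p q → (u * p + v * q) * w) (suc*[i/suc] b (+ 1)) (suc*[i/suc] a (+ 1)) ⟩
  (u * 1ℚ + v * 1ℚ) * w             ≡⟨ cong₂ (λ p q → (p + q) * w) (*-identityʳ u) (*-identityʳ v) ⟩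
  (u + v) * w                       ∎
  where
  x = fromℕ (suc a)
  y = fromℕ (suc b)
  u = 1/suc a
  v = 1/suc b
  w = 1/suc (suc (a ℕ.+ b))
  zw≡1 : (x + y) * w ≡ 1ℚ
  zw≡1 = begin
    (x + y) * w                          ≡⟨ cong (_* w) (sym (fromℕ-homo-+ (suc a) (suc b))) ⟩
    fromℕ (suc a ℕ.+ suc b) * w          ≡⟨ cong (λ k → fromℕ (suc k) * w) (ℕₚ.+-suc a b) ⟩
    fromℕ (suc (suc (a ℕ.+ b))) * w      ≡⟨ suc*[i/suc] (suc (a ℕ.+ b)) (+ 1) ⟩
    1ℚ                                   ∎

-- Sums over initial segments of ℕ

∑< : ℕ → (ℕ → ℚ) → ℚ
∑< zero    f = 0ℚ
∑< (suc n) f = f 0 + ∑< n (f ∘ suc)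

∑-applyUpTo : ∀ (g : ℕ → ℕ) n f → ∑ (applyUpTo g n) f ≡ ∑< n (f ∘ g)
∑-applyUpTo g zero    f = refl
∑-applyUpTo g (suc n) f = cong (_+_ (f (g 0))) (∑-applyUpTo (g ∘ suc) n f)

∑-upTo : ∀ n f → ∑ (upTo n) f ≡ ∑< n f
∑-upTo = ∑-applyUpTo id

∑-⋯ : ∀ a b f → ∑ (a ⋯ b) f ≡ ∑< (suc b ∸ a) (λ i → f (a ℕ.+ i))
∑-⋯ a b f = trans (cong (λ xs → ∑ xs f) (map-applyUpTo id (a ℕ.+_) (suc b ∸ a)))
                  (∑-applyUpTo (a ℕ.+_) (suc b ∸ a) f)

∑<-cong′ : ∀ n {f g : ℕ → ℚ} → (∀ i → i < n → f i ≡ g i) → ∑< n f ≡ ∑< n g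
∑<-cong′ zero    eq = refl
∑<-cong′ (suc n) eq = cong₂ _+_ (eq 0 (s≤s z≤n)) (∑<-cong′ n (λ i i<n → eq (suc i) (s≤s i<n)))

∑<-cong : ∀ n {f g : ℕ → ℚ} → f ≗ g → ∑< n f ≡ ∑< n g
∑<-cong n eq = ∑<-cong′ n (λ i _ → eq i)

∑<-zero : ∀ n {f : ℕ → ℚ} → (∀ i → f i ≡ 0ℚ) → ∑< n f ≡ 0ℚ
∑<-zero zero    f≡0 = refl
∑<-zero (suc n) f≡0 = cong₂ _+_ (f≡0 0) (∑<-zero n (f≡0 ∘ suc))

∑<-+ : ∀ n f g → ∑< n (λ i → f i + g i) ≡ ∑< n f + ∑< n g
∑<-+ zero    f g = refl
∑<-+ (suc n) f g = begin
  f 0 + g 0 + ∑< n (λ i → f (suc i) + g (suc i))      ≡⟨ cong (_+_ (f 0 + g 0)) (∑<-+ n (f ∘ suc) (g ∘ suc)) ⟩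
  f 0 + g 0 + (∑< n (f ∘ suc) + ∑< n (g ∘ suc))       ≡⟨ solve 4 (λ a b c d → a :+ b :+ (c :+ d) := (a :+ c) :+ (b :+ d)) refl (f 0) (g 0) _ _ ⟩
  (f 0 + ∑< n (f ∘ suc)) + (g 0 + ∑< n (g ∘ suc))     ∎

∑<-*ʳ : ∀ n f c → ∑< n (λ i → f i * c) ≡ ∑< n f * c
∑<-*ʳ zero    f c = sym (*-zeroˡ c)
∑<-*ʳ (suc n) f c = trans (cong (_+_ (f 0 * c)) (∑<-*ʳ n (f ∘ suc) c)) (sym (*-distribʳ-+ c (f 0) (∑< n (f ∘ suc))))

∑<-*ˡ : ∀ n c f → ∑< n (λ i → c * f i) ≡ c * ∑< n f
∑<-*ˡ n c f = trans (∑<-cong n (λ i → *-comm c (f i))) (trans (∑<-*ʳ n f c) (*-comm _ c))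

∑<-last : ∀ n f → ∑< (suc n) f ≡ ∑< n f + f n
∑<-last zero    f = +-comm (f 0) 0ℚ
∑<-last (suc n) f = trans (cong (_+_ (f 0)) (∑<-last n (f ∘ suc))) (sym (+-assoc (f 0) _ _))

∑<-reverse : ∀ n f → ∑< n (λ i → f (n ∸ suc i)) ≡ ∑< n f
∑<-reverse zero    f = refl
∑<-reverse (suc n) f = trans (cong (_+_ (f n)) (∑<-reverse n f)) (trans (+-comm (f n) _) (sym (∑<-last n f)))

-- Truncated subtraction is harmless: if n < p, the left sum is empty and every term on the right
-- vanishes. It lets the sum over j start at 1 instead of m.
∑<-drop : ∀ p n f → (∀ i → i < p → f i ≡ 0ℚ) → ∑< (n ∸ p) (λ i → f (p ℕ.+ i)) ≡ ∑< n f
∑<-drop zero    n       f f≡0 = refl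
∑<-drop (suc p) zero    f f≡0 = refl
∑<-drop (suc p) (suc n) f f≡0 = begin
  ∑< (n ∸ p) (λ i → f (suc p ℕ.+ i))  ≡⟨ ∑<-drop p n (f ∘ suc) (λ i i<p → f≡0 (suc i) (s≤s i<p)) ⟩
  ∑< n (f ∘ suc)                      ≡⟨ sym (+-identityˡ _) ⟩
  0ℚ + ∑< n (f ∘ suc)                 ≡⟨ cong (_+ ∑< n (f ∘ suc)) (sym (f≡0 0 (s≤s z≤n))) ⟩
  f 0 + ∑< n (f ∘ suc)                ∎

∑<-truncate : ∀ {b n} f → b ≤ n → (∀ i → b ≤ i → f i ≡ 0ℚ) → ∑< n f ≡ ∑< b f
∑<-truncate {n = n} f z≤n       f≡0 = ∑<-zero n (λ i → f≡0 i z≤n)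
∑<-truncate         f (s≤s b≤n) f≡0 = cong (_+_ (f 0)) (∑<-truncate (f ∘ suc) b≤n (λ i b≤i → f≡0 (suc i) (s≤s b≤i)))

-- Convolution and partial sums

⊛-zero : ∀ f g → (f ⊛ g) 0 ≡ f 0 * g 0
⊛-zero f g = +-identityʳ _

⊛-∑< : ∀ f g n → (f ⊛ g) n ≡ ∑< (suc n) (λ i → f i * g (n ∸ i))
⊛-∑< f g n = ∑-upTo (suc n) (λ i → f i * g (n ∸ i))

⊛-suc : ∀ f g n → (f ⊛ g) (suc n) ≡ f 0 * g (suc n) + ((f ∘ suc) ⊛ g) n
⊛-suc f g n = trans (⊛-∑< f g (suc n)) (cong (_+_ (f 0 * g (suc n))) (sym (⊛-∑< (f ∘ suc) g n)))

⊛-cong : ∀ {f f′ g g′} → f ≗ f′ → g ≗ g′ → f ⊛ g ≗ f′ ⊛ g′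
⊛-cong {f} {f′} {g} {g′} f≗ g≗ n = trans (⊛-∑< f g n)
  (trans (∑<-cong (suc n) (λ i → cong₂ _*_ (f≗ i) (g≗ (n ∸ i)))) (sym (⊛-∑< f′ g′ n)))

⊛-distribʳ-+ : ∀ f g h n → ((λ i → f i + g i) ⊛ h) n ≡ (f ⊛ h) n + (g ⊛ h) n
⊛-distribʳ-+ f g h n = begin
  ((λ i → f i + g i) ⊛ h) n                     ≡⟨ ⊛-∑< (λ i → f i + g i) h n ⟩
  ∑< (suc n) (λ i → (f i + g i) * h (n ∸ i))    ≡⟨ ∑<-cong (suc n) (λ i → *-distribʳ-+ (h (n ∸ i)) (f i) (g i)) ⟩
  ∑< (suc n) (λ i → F i + G i)                  ≡⟨ ∑<-+ (suc n) F G ⟩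
  ∑< (suc n) F + ∑< (suc n) G                   ≡⟨ sym (cong₂ _+_ (⊛-∑< f h n) (⊛-∑< g h n)) ⟩
  (f ⊛ h) n + (g ⊛ h) n                         ∎
  where
  F = λ i → f i * h (n ∸ i)
  G = λ i → g i * h (n ∸ i)

suc-∸-suc : ∀ {i n} → i < n → n ∸ i ≡ suc (n ∸ suc i)
suc-∸-suc {zero}  (s≤s _)   = refl
suc-∸-suc {suc i} (s≤s i<n) = suc-∸-suc i<n

-- Both end terms of the convolution contain a zero constant coefficient. With k = `suc i`, the
-- complementary index n+1-k is written as a successor, so that `L` computes on it.
⊛-interior : ∀ f g n → f 0 ≡ 0ℚ → g 0 ≡ 0ℚ →
             (f ⊛ g) (suc n) ≡ ∑< n (λ i → f (suc i) * g (suc (n ∸ suc i)))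
⊛-interior f g n f₀≡0 g₀≡0 = begin
  (f ⊛ g) (suc n)                                               ≡⟨ ⊛-suc f g n ⟩
  f 0 * g (suc n) + ((f ∘ suc) ⊛ g) n                           ≡⟨ cong₂ _+_ (trans (cong (_* g (suc n)) f₀≡0) (*-zeroˡ (g (suc n)))) (⊛-∑< (f ∘ suc) g n) ⟩
  0ℚ + ∑< (suc n) (λ i → f (suc i) * g (n ∸ i))                 ≡⟨ +-identityˡ _ ⟩
  ∑< (suc n) (λ i → f (suc i) * g (n ∸ i))                      ≡⟨ ∑<-last n _ ⟩
  ∑< n (λ i → f (suc i) * g (n ∸ i)) + f (suc n) * g (n ∸ n)    ≡⟨ cong₂ _+_ (∑<-cong′ n (λ i i<n → cong (λ k → f (suc i) * g k) (suc-∸-suc i<n))) last≡0 ⟩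
  ∑< n (λ i → f (suc i) * g (suc (n ∸ suc i))) + 0ℚ             ≡⟨ +-identityʳ _ ⟩
  ∑< n (λ i → f (suc i) * g (suc (n ∸ suc i)))                  ∎
  where
  last≡0 : f (suc n) * g (n ∸ n) ≡ 0ℚ
  last≡0 = trans (cong (λ k → f (suc n) * g k) (ℕₚ.n∸n≡0 n)) (trans (cong (f (suc n) *_) g₀≡0) (*-zeroʳ (f (suc n))))

-- Multiplication by 1/(1-x).
partialSums : Series → Series
partialSums f n = ∑< (suc n) f

-- Together with `partialSums-⊛ʳ`: the factor 1/(1-x) of a product may be attached to either of its
-- factors.
partialSums-⊛ˡ : ∀ f g n → partialSums (f ⊛ g) n ≡ (partialSums f ⊛ g) n
partialSums-⊛ˡ f g zero    = begin
  (f ⊛ g) 0 + 0ℚ             ≡⟨ cong (_+ 0ℚ) (⊛-zero f g) ⟩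
  f 0 * g 0 + 0ℚ             ≡⟨ cong (λ x → x * g 0 + 0ℚ) (sym (+-identityʳ (f 0))) ⟩
  (f 0 + 0ℚ) * g 0 + 0ℚ      ∎
partialSums-⊛ˡ f g (suc n) = begin
  partialSums (f ⊛ g) (suc n)                                      ≡⟨ ∑<-last (suc n) (f ⊛ g) ⟩
  partialSums (f ⊛ g) n + (f ⊛ g) (suc n)                          ≡⟨ cong₂ _+_ (partialSums-⊛ˡ f g n) (⊛-suc f g n) ⟩
  (P ⊛ g) n + (f 0 * g (suc n) + ((f ∘ suc) ⊛ g) n)                ≡⟨ solve 3 (λ a b c → a :+ (b :+ c) := b :+ (a :+ c)) refl ((P ⊛ g) n) (f 0 * g (suc n)) _ ⟩
  f 0 * g (suc n) + ((P ⊛ g) n + ((f ∘ suc) ⊛ g) n)                ≡⟨ cong (_+_ (f 0 * g (suc n))) (sym (⊛-distribʳ-+ P (f ∘ suc) g n)) ⟩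
  -- Since P (i+1) = P i + f (i+1) and P 0 = f 0, head and tail recombine into the recursion of `⊛`
  -- for `P`.
  f 0 * g (suc n) + ((λ i → P i + f (suc i)) ⊛ g) n                ≡⟨ cong₂ _+_ (cong (_* g (suc n)) (sym (+-identityʳ (f 0)))) (⊛-cong {g = g} (λ i → sym (∑<-last (suc i) f)) (λ _ → refl) n) ⟩
  P 0 * g (suc n) + ((P ∘ suc) ⊛ g) n                              ≡⟨ sym (⊛-suc P g n) ⟩
  (P ⊛ g) (suc n)                                                  ∎
  where P = partialSums f

-- Summing the recursion `⊛-suc` leaves the same claim for the tail `f ∘ suc`, so the induction on n
-- lets `f` vary.
partialSums-⊛ʳ : ∀ f g n → partialSums (f ⊛ g) n ≡ (f ⊛ partialSums g) n
partialSums-⊛ʳ f g zero    = begin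
  (f ⊛ g) 0 + 0ℚ             ≡⟨ cong (_+ 0ℚ) (⊛-zero f g) ⟩
  f 0 * g 0 + 0ℚ             ≡⟨ cong (λ x → f 0 * x + 0ℚ) (sym (+-identityʳ (g 0))) ⟩
  f 0 * (g 0 + 0ℚ) + 0ℚ      ∎
partialSums-⊛ʳ f g (suc n) = begin
  (f ⊛ g) 0 + ∑< (suc n) ((f ⊛ g) ∘ suc)
    ≡⟨ cong₂ _+_ (⊛-zero f g) (trans (∑<-cong (suc n) (⊛-suc f g)) (∑<-+ (suc n) (λ i → f 0 * g (suc i)) ((f ∘ suc) ⊛ g))) ⟩
  f 0 * g 0 + (∑< (suc n) (λ i → f 0 * g (suc i)) + partialSums ((f ∘ suc) ⊛ g) n)
    ≡⟨ cong (_+_ (f 0 * g 0)) (cong₂ _+_ (∑<-*ˡ (suc n) (f 0) (g ∘ suc)) (partialSums-⊛ʳ (f ∘ suc) g n)) ⟩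
  f 0 * g 0 + (f 0 * ∑< (suc n) (g ∘ suc) + ((f ∘ suc) ⊛ partialSums g) n)
    ≡⟨ solve 4 (λ a b c d → a :* b :+ (a :* c :+ d) := a :* (b :+ c) :+ d) refl (f 0) (g 0) _ _ ⟩
  f 0 * partialSums g (suc n) + ((f ∘ suc) ⊛ partialSums g) n
    ≡⟨ sym (⊛-suc f (partialSums g) n) ⟩
  (f ⊛ partialSums g) (suc n)
    ∎

^ˢ-zero : ∀ f m → f 0 ≡ 0ℚ → (f ^ˢ suc m) 0 ≡ 0ℚ
^ˢ-zero f m f₀≡0 = trans (⊛-zero f (f ^ˢ m)) (trans (cong (_* (f ^ˢ m) 0) f₀≡0) (*-zeroˡ ((f ^ˢ m) 0)))

-- The binomial transform

-- The coefficients of (1-x)⁻¹ f(x/(1-x)); see binomial-∑ for the closed form.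
binomial : Series → Series
binomial f zero    = f 0
binomial f (suc n) = binomial f n + binomial (f ∘ suc) n

-- The coefficients of f(x/(1-x)).
euler : Series → Series
euler f zero    = f 0
euler f (suc n) = binomial (f ∘ suc) n

binomial-cong : ∀ {f g} → f ≗ g → binomial f ≗ binomial g
binomial-cong eq zero    = eq 0
binomial-cong eq (suc n) = cong₂ _+_ (binomial-cong eq n) (binomial-cong (eq ∘ suc) n)

binomial-+ : ∀ f g n → binomial (λ i → f i + g i) n ≡ binomial f n + binomial g n
binomial-+ f g zero    = refl
binomial-+ f g (suc n) = trans (cong₂ _+_ (binomial-+ f g n) (binomial-+ (f ∘ suc) (g ∘ suc) n))
  (solve 4 (λ a b c d → a :+ b :+ (c :+ d) := (a :+ c) :+ (b :+ d)) refl
    (binomial f n) (binomial g n) (binomial (f ∘ suc) n) (binomial (g ∘ suc) n))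

binomial-* : ∀ c f n → binomial (λ i → c * f i) n ≡ c * binomial f n
binomial-* c f zero    = refl
binomial-* c f (suc n) = trans (cong₂ _+_ (binomial-* c f n) (binomial-* c (f ∘ suc) n))
                               (sym (*-distribˡ-+ c _ _))

binomial-∑ : ∀ f n → binomial f n ≡ ∑< (suc n) (λ i → fromℕ (n C i) * f i)
binomial-∑ f zero    = sym (trans (+-identityʳ _) (*-identityˡ (f 0)))
binomial-∑ f (suc n) = begin
  binomial f n + binomial (f ∘ suc) n
    ≡⟨ cong₂ _+_ (binomial-∑ f n) (binomial-∑ (f ∘ suc) n) ⟩
  ∑< (suc n) F + A
    -- The extra term has n C (n+1) = 0. It lengthens the sum so that, after splitting off the head,
    -- the remaining terms pair with those of `A` for Pascal's rule.
    ≡⟨ cong (_+ A) (sym (trans (cong (_+_ (∑< (suc n) F)) last≡0) (+-identityʳ (∑< (suc n) F)))) ⟩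
  ∑< (suc n) F + F (suc n) + A
    ≡⟨ cong (_+ A) (sym (∑<-last (suc n) F)) ⟩
  fromℕ 1 * f 0 + ∑< (suc n) (F ∘ suc) + A
    ≡⟨ solve 3 (λ a b c → a :+ b :+ c := a :+ (c :+ b)) refl (fromℕ 1 * f 0) (∑< (suc n) (F ∘ suc)) A ⟩
  fromℕ 1 * f 0 + (A + ∑< (suc n) (F ∘ suc))
    ≡⟨ cong (_+_ (fromℕ 1 * f 0)) (sym (∑<-+ (suc n) (λ i → fromℕ (n C i) * f (suc i)) (F ∘ suc))) ⟩
  fromℕ 1 * f 0 + ∑< (suc n) (λ i → fromℕ (n C i) * f (suc i) + fromℕ (n C suc i) * f (suc i))
    ≡⟨ cong (_+_ (fromℕ 1 * f 0)) (∑<-cong (suc n) pascal) ⟩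
  fromℕ 1 * f 0 + ∑< (suc n) (λ i → fromℕ (suc n C suc i) * f (suc i))
    ∎
  where
  F = λ i → fromℕ (n C i) * f i
  A = ∑< (suc n) (λ i → fromℕ (n C i) * f (suc i))
  last≡0 : fromℕ (n C suc n) * f (suc n) ≡ 0ℚ
  last≡0 = trans (cong (λ k → fromℕ k * f (suc n)) (k>n⇒nCk≡0 (ℕₚ.n<1+n n))) (*-zeroˡ (f (suc n)))
  pascal : ∀ i → fromℕ (n C i) * f (suc i) + fromℕ (n C suc i) * f (suc i) ≡ fromℕ (suc n C suc i) * f (suc i)
  pascal i = begin
    fromℕ (n C i) * f (suc i) + fromℕ (n C suc i) * f (suc i)   ≡⟨ sym (*-distribʳ-+ (f (suc i)) (fromℕ (n C i)) (fromℕ (n C suc i))) ⟩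
    (fromℕ (n C i) + fromℕ (n C suc i)) * f (suc i)             ≡⟨ cong (_* f (suc i)) (sym (fromℕ-homo-+ (n C i) (n C suc i))) ⟩
    fromℕ (n C i ℕ.+ n C suc i) * f (suc i)                     ≡⟨ cong (λ k → fromℕ k * f (suc i)) (nCk+nC[k+1]≡[n+1]C[k+1] n i) ⟩
    fromℕ (suc n C suc i) * f (suc i)                           ∎

-- The common inductive step of `binomial-⊛` and `euler-⊛`: dropping the constant term of a product
-- leaves f 0 times the tail of g, plus the tail of f times g.
binomial-⊛-suc : ∀ f g n → binomial ((f ⊛ g) ∘ suc) n ≡ f 0 * binomial (g ∘ suc) n + binomial ((f ∘ suc) ⊛ g) n
binomial-⊛-suc f g n = begin
  binomial ((f ⊛ g) ∘ suc) n
    ≡⟨ binomial-cong (⊛-suc f g) n ⟩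
  binomial (λ i → f 0 * g (suc i) + ((f ∘ suc) ⊛ g) i) n
    ≡⟨ binomial-+ (λ i → f 0 * g (suc i)) ((f ∘ suc) ⊛ g) n ⟩
  binomial (λ i → f 0 * g (suc i)) n + binomial ((f ∘ suc) ⊛ g) n
    ≡⟨ cong (_+ binomial ((f ∘ suc) ⊛ g) n) (binomial-* (f 0) (g ∘ suc) n) ⟩
  f 0 * binomial (g ∘ suc) n + binomial ((f ∘ suc) ⊛ g) n
    ∎

-- Substitution of x/(1-x) is multiplicative, and the single prefactor 1/(1-x) goes to the first
-- factor; hence `binomial` on one side and `euler` on the other.
binomial-⊛ : ∀ f g n → binomial (f ⊛ g) n ≡ (binomial f ⊛ euler g) n
binomial-⊛ f g zero    = refl
binomial-⊛ f g (suc n) = begin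
  binomial (f ⊛ g) n + binomial ((f ⊛ g) ∘ suc) n
    ≡⟨ cong₂ _+_ (binomial-⊛ f g n) (binomial-⊛-suc f g n) ⟩
  (binomial f ⊛ euler g) n + (f 0 * euler g (suc n) + binomial ((f ∘ suc) ⊛ g) n)
    ≡⟨ cong (λ x → (binomial f ⊛ euler g) n + (f 0 * euler g (suc n) + x)) (binomial-⊛ (f ∘ suc) g n) ⟩
  (binomial f ⊛ euler g) n + (f 0 * euler g (suc n) + (binomial (f ∘ suc) ⊛ euler g) n)
    ≡⟨ solve 3 (λ a b c → a :+ (b :+ c) := b :+ (a :+ c)) refl ((binomial f ⊛ euler g) n) (f 0 * euler g (suc n)) ((binomial (f ∘ suc) ⊛ euler g) n) ⟩
  f 0 * euler g (suc n) + ((binomial f ⊛ euler g) n + (binomial (f ∘ suc) ⊛ euler g) n)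
    ≡⟨ cong (_+_ (f 0 * euler g (suc n))) (sym (⊛-distribʳ-+ (binomial f) (binomial (f ∘ suc)) (euler g) n)) ⟩
  -- The pointwise sum of `binomial f` and `binomial (f ∘ suc)` is the tail of `binomial f` by
  -- definition.
  f 0 * euler g (suc n) + ((binomial f ∘ suc) ⊛ euler g) n
    ≡⟨ sym (⊛-suc (binomial f) (euler g) n) ⟩
  (binomial f ⊛ euler g) (suc n)
    ∎

euler-⊛ : ∀ f g → euler (f ⊛ g) ≗ euler f ⊛ euler g
euler-⊛ f g zero    = refl
euler-⊛ f g (suc n) = begin
  binomial ((f ⊛ g) ∘ suc) n
    ≡⟨ binomial-⊛-suc f g n ⟩
  f 0 * euler g (suc n) + binomial ((f ∘ suc) ⊛ g) n
    ≡⟨ cong (_+_ (f 0 * euler g (suc n))) (binomial-⊛ (f ∘ suc) g n) ⟩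
  f 0 * euler g (suc n) + ((euler f ∘ suc) ⊛ euler g) n
    ≡⟨ sym (⊛-suc (euler f) (euler g) n) ⟩
  (euler f ⊛ euler g) (suc n)
    ∎

binomial-zero : ∀ n → binomial (λ _ → 0ℚ) n ≡ 0ℚ
binomial-zero zero    = refl
binomial-zero (suc n) = cong₂ _+_ (binomial-zero n) (binomial-zero n)

euler-one : euler one ≗ one
euler-one zero    = refl
euler-one (suc n) = binomial-zero n

euler-^ˢ : ∀ f m → euler (f ^ˢ m) ≗ euler f ^ˢ m
euler-^ˢ f zero      = euler-one
euler-^ˢ f (suc m) n = trans (euler-⊛ f (f ^ˢ m) n) (⊛-cong {euler f} (λ _ → refl) (euler-^ˢ f m) n)

^ˢ-cong : ∀ {f g} → f ≗ g → ∀ m → f ^ˢ m ≗ g ^ˢ m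
^ˢ-cong eq zero    _ = refl
^ˢ-cong eq (suc m)   = ⊛-cong eq (^ˢ-cong eq m)

-- Summed form of i C(n+1,i) = (n+1) C(n,i-1).
binomial-absorption : ∀ f n → binomial (λ i → fromℕ i * f i) (suc n) ≡ fromℕ (suc n) * binomial (f ∘ suc) n
binomial-absorption f zero    = trans (cong (_+ fromℕ 1 * f 1) (*-zeroˡ (f 0))) (+-identityˡ _)
binomial-absorption f (suc n) = begin
  binomial θf (suc n) + binomial (θf ∘ suc) (suc n)
    ≡⟨ cong₂ _+_ (binomial-absorption f n) (trans (binomial-cong shift (suc n)) (binomial-+ θf′ f′ (suc n))) ⟩
  N * binomial f′ n + (binomial θf′ (suc n) + binomial f′ (suc n))
    ≡⟨ cong (λ x → N * binomial f′ n + (x + binomial f′ (suc n))) (binomial-absorption f′ n) ⟩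
  N * binomial f′ n + (N * binomial (f′ ∘ suc) n + binomial f′ (suc n))
    -- `binomial f′ (suc n)` unfolds to a + b, so N(a+b) and the remaining a + b combine to
    -- (1+N)(a+b).
    ≡⟨ solve 3 (λ N a b → N :* a :+ (N :* b :+ (a :+ b)) := (con 1ℚ :+ N) :* (a :+ b)) refl N (binomial f′ n) (binomial (f′ ∘ suc) n) ⟩
  (1ℚ + N) * binomial f′ (suc n)
    ≡⟨ cong (_* binomial f′ (suc n)) (sym (fromℕ-suc (suc n))) ⟩
  fromℕ (suc (suc n)) * binomial f′ (suc n)
    ∎
  where
  N   = fromℕ (suc n)
  f′  = f ∘ suc
  θf  = λ i → fromℕ i * f i
  θf′ = λ i → fromℕ i * f′ i
  shift : ∀ i → θf (suc i) ≡ θf′ i + f′ i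
  shift i = trans (cong (_* f′ i) (fromℕ-suc i))
    (solve 2 (λ a b → (con 1ℚ :+ a) :* b := a :* b :+ b) refl (fromℕ i) (f′ i))

-- The logarithm

-- -ln(1-x)
L : Series
L zero    = 0ℚ
L (suc n) = 1/suc n

alternating : Series
alternating n = (-1ℤ ℤ.^ n) / 1

-- `alternating` is 1/(1+z), which becomes 1-x at z = x/(1-x). The prefactor 1/(1-x) turns it into
-- the constant series 1, whose higher coefficients vanish.
binomial-alternating : ∀ n → binomial alternating (suc n) ≡ 0ℚ
binomial-alternating n = begin
  binomial alternating n + binomial (alternating ∘ suc) n               ≡⟨ cong (_+_ (binomial alternating n)) (trans (binomial-cong step n) (binomial-* (- 1ℚ) alternating n)) ⟩
  binomial alternating n + - 1ℚ * binomial alternating n                ≡⟨ solve 1 (λ a → a :+ con (- 1ℚ) :* a := con 0ℚ) refl (binomial alternating n) ⟩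
  0ℚ                                                                    ∎
  where
  step : ∀ i → alternating (suc i) ≡ - 1ℚ * alternating i
  step i = /-homo-* -1ℤ (-1ℤ ℤ.^ i) 1 1

-- Formally, ln(1 + x/(1-x)) = -ln(1-x). On coefficients, absorption reduces the claim to the
-- binomial transform of i [zⁱ] ln(1+z), which `θln` shows to be 1 at every positive index.
euler-ln : euler ln[1+z] ≗ L
euler-ln zero    = refl
euler-ln (suc n) = 1/suc-unique n _ (trans (sym (binomial-absorption ln[1+z] n)) (θln n))
  where
  θln : ∀ n → binomial (λ i → fromℕ i * ln[1+z] i) (suc n) ≡ 1ℚ
  θln zero    = refl
  -- Shifted by one, the sequence i [zⁱ] ln(1+z) is `alternating`, so passing to the next index adds
  -- 0.
  θln (suc n) = cong₂ _+_ (θln n)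
    (trans (binomial-cong (λ i → suc*[i/suc] i (-1ℤ ℤ.^ i)) (suc n)) (binomial-alternating n))

partialSums-L : ∀ n → partialSums L n ≡ H n
partialSums-L n = trans (+-identityˡ _) (sym (∑-upTo n _))

-- By the generating function, s(j,m+1)/j! is the coefficient of zʲ in ln(1+z)ᵐ⁺¹/(m+1)!. It
-- vanishes for j < m+1, so the range may be extended down to j = 1, which makes the sum a full
-- binomial transform.
stirling-sum : ∀ m N → ∑[ j ∈ suc m ⋯ suc N ] (fromℕ (N C (j ∸ 1)) * (s j (suc m) * 1/ j !))
                       ≡ (L ^ˢ suc m) (suc N) * 1/ suc m !
stirling-sum m N = begin
  ∑ (suc m ⋯ suc N) t                                       ≡⟨ ∑-⋯ (suc m) (suc N) t ⟩
  ∑< (suc N ∸ m) (λ i → t (suc (m ℕ.+ i)))                  ≡⟨ ∑<-drop m (suc N) (t ∘ suc) vanish ⟩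
  ∑< (suc N) (t ∘ suc)                                      ≡⟨ ∑<-cong (suc N) factor ⟩
  ∑< (suc N) (λ i → fromℕ (N C i) * c (suc i) * d)          ≡⟨ ∑<-*ʳ (suc N) (λ i → fromℕ (N C i) * c (suc i)) d ⟩
  ∑< (suc N) (λ i → fromℕ (N C i) * c (suc i)) * d          ≡⟨ cong (_* d) (sym (binomial-∑ (c ∘ suc) N)) ⟩
  -- `euler c (suc N)` unfolds to `binomial (c ∘ suc) N`. Substitution commutes with powers and
  -- sends `ln[1+z]` to `L`.
  euler c (suc N) * d                                       ≡⟨ cong (_* d) (trans (euler-^ˢ ln[1+z] (suc m) (suc N)) (^ˢ-cong euler-ln (suc m) (suc N))) ⟩
  (L ^ˢ suc m) (suc N) * d                                  ∎
  where
  c = ln[1+z] ^ˢ suc m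
  d = 1/ suc m !
  t : ℕ → ℚ
  t j = fromℕ (N C (j ∸ 1)) * (s j (suc m) * 1/ j !)
  vanish : ∀ i → i < m → t (suc i) ≡ 0ℚ
  vanish i i<m = trans (cong (λ x → fromℕ (N C i) * (x * 1/ suc i !)) (s-vanish (suc i) (suc m) (s≤s i<m)))
    (trans (cong (fromℕ (N C i) *_) (*-zeroˡ (1/ suc i !))) (*-zeroʳ (fromℕ (N C i))))
  factor : ∀ i → t (suc i) ≡ fromℕ (N C i) * c (suc i) * d
  factor i = trans (cong (fromℕ (N C i) *_) (s-egf (suc i) (suc m))) (sym (*-assoc (fromℕ (N C i)) (c (suc i)) d))

-- Sums over tuples

∑-cong : {A : Set} (xs : List A) {f g : A → ℚ} → f ≗ g → ∑ xs f ≡ ∑ xs g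
∑-cong []       eq = refl
∑-cong (x ∷ xs) eq = cong₂ _+_ (eq x) (∑-cong xs eq)

∑-zero : {A : Set} (xs : List A) → ∑ xs (λ _ → 0ℚ) ≡ 0ℚ
∑-zero []       = refl
∑-zero (x ∷ xs) = trans (+-identityˡ _) (∑-zero xs)

∑-*ˡ : {A : Set} (xs : List A) (c : ℚ) (f : A → ℚ) → ∑ xs (λ x → c * f x) ≡ c * ∑ xs f
∑-*ˡ []       c f = sym (*-zeroʳ c)
∑-*ˡ (x ∷ xs) c f = trans (cong (_+_ (c * f x)) (∑-*ˡ xs c f)) (sym (*-distribˡ-+ c (f x) _))

∑-++ : {A : Set} (xs ys : List A) (f : A → ℚ) → ∑ (xs ++ ys) f ≡ ∑ xs f + ∑ ys f
∑-++ []       ys f = sym (+-identityˡ _)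
∑-++ (x ∷ xs) ys f = trans (cong (_+_ (f x)) (∑-++ xs ys f)) (sym (+-assoc (f x) _ _))

∑-map : {A B : Set} (g : A → B) (xs : List A) (f : B → ℚ) → ∑ (map g xs) f ≡ ∑ xs (f ∘ g)
∑-map g []       f = refl
∑-map g (x ∷ xs) f = cong (_+_ (f (g x))) (∑-map g xs f)

∑-cartesianProductWith : {A B C : Set} (g : A → B → C) (xs : List A) (ys : List B) (f : C → ℚ) →
                         ∑ (cartesianProductWith g xs ys) f ≡ ∑ xs (λ x → ∑ ys (λ y → f (g x y)))
∑-cartesianProductWith g []       ys f = refl
∑-cartesianProductWith g (x ∷ xs) ys f = trans (∑-++ (map (g x) ys) _ f)
  (cong₂ _+_ (∑-map (g x) ys f) (∑-cartesianProductWith g xs ys f))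

∑-tabulate : {A : Set} (n : ℕ) (g : Fin n → A) (f : A → ℚ) (h : ℕ → ℚ) →
             (∀ i → f (g i) ≡ h (toℕ i)) → ∑ (tabulate g) f ≡ ∑< n h
∑-tabulate zero    g f h eq = refl
∑-tabulate (suc n) g f h eq = cong₂ _+_ (eq Fin.zero) (∑-tabulate n (g ∘ Fin.suc) f (h ∘ suc) (eq ∘ Fin.suc))

∑-filter : {A : Set} {P : A → Set} (P? : Decidable P) (xs : List A) (f : A → ℚ) →
           ∑ (filter P? xs) f ≡ ∑ xs (λ x → if does (P? x) then f x else 0ℚ)
∑-filter P? []       f = refl
∑-filter P? (x ∷ xs) f with does (P? x)
... | true  = cong (_+_ (f x)) (∑-filter P? xs f)
... | false = trans (∑-filter P? xs f) (sym (+-identityˡ _))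

1/product-∷ : ∀ {m n} (i : Fin n) (ks : Vec (Fin n) m) → 1/product (i ∷ ks) ≡ 1/suc (toℕ i) * 1/product ks
1/product-∷ i ks = /-homo-* (+ 1) (+ 1) (suc (toℕ i)) (product (values ks)) {{_}} {{product≢0 ks}} {{product≢0 (i ∷ ks)}}

-- The bound `b` on the sum is kept apart from the range `n` of the entries: removing an entry
-- lowers the bound while the remaining tuple still lives over `Fin n`.
1/product≤ : ∀ {m n} → ℕ → Vec (Fin n) m → ℚ
1/product≤ b ks = if Vec.sum (values ks) ≤ᵇ b then 1/product ks else 0ℚ

+-≤ᵇ-inside : ∀ {i b} s → i ≤ b → (i ℕ.+ s ≤ᵇ b) ≡ (s ≤ᵇ b ∸ i)
+-≤ᵇ-inside s z≤n = refl
+-≤ᵇ-inside {suc i} {suc b} s (s≤s i≤b) = trans (suc-≤ᵇ (i ℕ.+ s) b) (+-≤ᵇ-inside s i≤b)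
  where
  suc-≤ᵇ : ∀ m n → (suc m ≤ᵇ suc n) ≡ (m ≤ᵇ n)
  suc-≤ᵇ zero    n = refl
  suc-≤ᵇ (suc m) n = refl

+-≤ᵇ-outside : ∀ {i b} s → b ≤ i → (suc i ℕ.+ s ≤ᵇ b) ≡ false
+-≤ᵇ-outside         s z≤n       = refl
+-≤ᵇ-outside {suc i} s (s≤s b≤i) = +-≤ᵇ-outside {i} s b≤i

*-if : ∀ (c : ℚ) (t : Bool) (x : ℚ) → (if t then c * x else 0ℚ) ≡ c * (if t then x else 0ℚ)
*-if c true  x = refl
*-if c false x = sym (*-zeroʳ c)

-- Split off the first entry k. If k > b nothing survives; otherwise the remaining entries have sum
-- at most b-k, and the induction hypothesis gives a convolution of `L` with the partial sums of its
-- m-th power. `partialSums-⊛ʳ` then moves the factor 1/(1-x) outside.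
∑-tuples : ∀ m {n b} → b ≤ n → ∑ (tuples m n) (1/product≤ b) ≡ partialSums (L ^ˢ m) b
-- The empty tuple has sum 0, which passes every bound, and all partial sums of `one` are 1.
∑-tuples zero    {n} {b} b≤n = cong (λ x → 1ℚ + x) (sym (∑<-zero b (λ _ → refl)))
∑-tuples (suc m) {n} {b} b≤n = begin
  ∑ (tuples (suc m) n) (1/product≤ b)
    ≡⟨ ∑-cartesianProductWith _∷_ (tabulate id) (tuples m n) (1/product≤ b) ⟩
  ∑ (tabulate id) (λ i → ∑ (tuples m n) (λ ks → 1/product≤ b (i ∷ ks)))
    ≡⟨ ∑-tabulate n id _ h (λ i → ∑-cong (tuples m n) (expand i)) ⟩
  ∑< n h
    ≡⟨ ∑<-truncate h b≤n outside ⟩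
  ∑< b h
    ≡⟨ ∑<-cong′ b inside ⟩
  ∑< b (λ i → L (suc i) * Pm (b ∸ suc i))
    ≡⟨ sym (convolution b) ⟩
  (L ⊛ Pm) b
    ≡⟨ sym (partialSums-⊛ʳ L (L ^ˢ m) b) ⟩
  partialSums (L ^ˢ suc m) b
    ∎
  where
  Pm = partialSums (L ^ˢ m)
  h : ℕ → ℚ
  h i = ∑ (tuples m n) (λ ks → if suc i ℕ.+ Vec.sum (values ks) ≤ᵇ b then 1/suc i * 1/product ks else 0ℚ)
  expand : ∀ i ks → 1/product≤ b (i ∷ ks)
                    ≡ (if suc (toℕ i) ℕ.+ Vec.sum (values ks) ≤ᵇ b then 1/suc (toℕ i) * 1/product ks else 0ℚ)
  expand i ks = cong (λ x → if suc (toℕ i) ℕ.+ Vec.sum (values ks) ≤ᵇ b then x else 0ℚ) (1/product-∷ i ks)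
  outside : ∀ i → b ≤ i → h i ≡ 0ℚ
  outside i b≤i = trans
    (∑-cong (tuples m n) (λ ks → cong (λ t → if t then 1/suc i * 1/product ks else 0ℚ) (+-≤ᵇ-outside (Vec.sum (values ks)) b≤i)))
    (∑-zero (tuples m n))
  inside : ∀ i → i < b → h i ≡ 1/suc i * Pm (b ∸ suc i)
  inside i i<b = begin
    h i
      ≡⟨ ∑-cong (tuples m n) (λ ks → trans
           (cong (λ t → if t then 1/suc i * 1/product ks else 0ℚ) (+-≤ᵇ-inside (Vec.sum (values ks)) i<b))
           (*-if (1/suc i) _ (1/product ks))) ⟩
    ∑ (tuples m n) (λ ks → 1/suc i * 1/product≤ (b ∸ suc i) ks)
      ≡⟨ ∑-*ˡ (tuples m n) (1/suc i) (1/product≤ (b ∸ suc i)) ⟩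
    1/suc i * ∑ (tuples m n) (1/product≤ (b ∸ suc i))
      ≡⟨ cong (1/suc i *_) (∑-tuples m (ℕₚ.≤-trans (ℕₚ.m∸n≤m b (suc i)) b≤n)) ⟩
    1/suc i * Pm (b ∸ suc i)
      ∎
  convolution : ∀ b → (L ⊛ Pm) b ≡ ∑< b (λ i → L (suc i) * Pm (b ∸ suc i))
  convolution b = begin
    (L ⊛ Pm) b                                                   ≡⟨ ⊛-∑< L Pm b ⟩
    0ℚ * Pm b + ∑< b (λ i → L (suc i) * Pm (b ∸ suc i))          ≡⟨ cong (_+ ∑< b (λ i → L (suc i) * Pm (b ∸ suc i))) (*-zeroˡ (Pm b)) ⟩
    0ℚ + ∑< b (λ i → L (suc i) * Pm (b ∸ suc i))                 ≡⟨ +-identityˡ _ ⟩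
    ∑< b (λ i → L (suc i) * Pm (b ∸ suc i))                      ∎

-- The series Lᵐ⁺¹/(1-x) is regrouped as (L/(1-x)) Lᵐ, whose first factor generates the harmonic
-- numbers.
H[,]-convolution : ∀ n m → H[ n , suc m ] ≡ (H ⊛ (L ^ˢ m)) n
H[,]-convolution n m = begin
  ∑ (filter inRange? (tuples (suc m) n)) 1/product    ≡⟨ ∑-filter inRange? (tuples (suc m) n) 1/product ⟩
  -- For a nonempty tuple the sum is a successor, so the test that it is at least 1 evaluates to
  -- true and only the upper bound remains.
  ∑ (tuples (suc m) n) _                              ≡⟨ ∑-cong (tuples (suc m) n) (λ { (i ∷ ks) → refl }) ⟩
  ∑ (tuples (suc m) n) (1/product≤ n)                 ≡⟨ ∑-tuples (suc m) {n} ℕₚ.≤-refl ⟩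
  partialSums (L ⊛ (L ^ˢ m)) n                        ≡⟨ partialSums-⊛ˡ L (L ^ˢ m) n ⟩
  (partialSums L ⊛ (L ^ˢ m)) n                        ≡⟨ ⊛-cong {g = L ^ˢ m} partialSums-L (λ _ → refl) n ⟩
  (H ⊛ (L ^ˢ m)) n                                    ∎

-- The square of the logarithm

H-suc : ∀ n → H (suc n) ≡ H n + 1/suc n
H-suc n = trans (∑-upTo (suc n) 1/suc) (trans (∑<-last n 1/suc) (cong (_+ 1/suc n) (sym (∑-upTo n 1/suc))))

H⁽²⁾-suc : ∀ n → H⁽²⁾ (suc n) ≡ H⁽²⁾ n + 1/suc n * 1/suc n
H⁽²⁾-suc n = begin
  H⁽²⁾ (suc n)                  ≡⟨ ∑-upTo (suc n) 1/suc² ⟩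
  ∑< (suc n) 1/suc²             ≡⟨ ∑<-last n 1/suc² ⟩
  ∑< n 1/suc² + 1/suc² n        ≡⟨ cong₂ _+_ (sym (∑-upTo n 1/suc²)) (/-homo-* (+ 1) (+ 1) (suc n) (suc n)) ⟩
  H⁽²⁾ n + 1/suc n * 1/suc n    ∎
  where
  1/suc² : ℕ → ℚ
  1/suc² i = + 1 / (suc i ℕ.* suc i)

-- In each term the two denominators add up to n+1, so partial fractions extract the factor 1/(n+1).
-- The two sums left are reflections of each other, both equal to `H n`.
L⊛L-suc : ∀ n → (L ⊛ L) (suc n) ≡ (H n + H n) * 1/suc n
L⊛L-suc n = begin
  (L ⊛ L) (suc n)                                                   ≡⟨ ⊛-interior L L n refl refl ⟩
  ∑< n (λ i → 1/suc i * 1/suc (n ∸ suc i))                          ≡⟨ ∑<-cong′ n split ⟩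
  ∑< n (λ i → (1/suc i + 1/suc (n ∸ suc i)) * 1/suc n)              ≡⟨ ∑<-*ʳ n _ (1/suc n) ⟩
  ∑< n (λ i → 1/suc i + 1/suc (n ∸ suc i)) * 1/suc n                ≡⟨ cong (_* 1/suc n) (∑<-+ n 1/suc (λ i → 1/suc (n ∸ suc i))) ⟩
  (∑< n 1/suc + ∑< n (λ i → 1/suc (n ∸ suc i))) * 1/suc n           ≡⟨ cong (λ x → (∑< n 1/suc + x) * 1/suc n) (∑<-reverse n 1/suc) ⟩
  (∑< n 1/suc + ∑< n 1/suc) * 1/suc n                               ≡⟨ cong (λ x → (x + x) * 1/suc n) (sym (∑-upTo n 1/suc)) ⟩
  (H n + H n) * 1/suc n                                             ∎
  where
  split : ∀ i → i < n → 1/suc i * 1/suc (n ∸ suc i) ≡ (1/suc i + 1/suc (n ∸ suc i)) * 1/suc n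
  split i i<n = trans (1/suc-partial-fractions i (n ∸ suc i))
    (cong (λ k → (1/suc i + 1/suc (n ∸ suc i)) * 1/suc k) (ℕₚ.m+[n∸m]≡n i<n))

partialSums-L⊛L : ∀ n → partialSums (L ⊛ L) n ≡ H n * H n - H⁽²⁾ n
partialSums-L⊛L zero    = refl
partialSums-L⊛L (suc n) = begin
  partialSums (L ⊛ L) (suc n)                             ≡⟨ ∑<-last (suc n) (L ⊛ L) ⟩
  partialSums (L ⊛ L) n + (L ⊛ L) (suc n)                 ≡⟨ cong₂ _+_ (partialSums-L⊛L n) (L⊛L-suc n) ⟩
  (h * h - h₂) + (h + h) * r                              ≡⟨ solve 3 (λ h h₂ r → (h :* h :- h₂) :+ (h :+ h) :* r := (h :+ r) :* (h :+ r) :- (h₂ :+ r :* r)) refl h h₂ r ⟩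
  (h + r) * (h + r) - (h₂ + r * r)                        ≡⟨ cong₂ (λ x y → x * x - y) (sym (H-suc n)) (sym (H⁽²⁾-suc n)) ⟩
  H (suc n) * H (suc n) - H⁽²⁾ (suc n)                    ∎
  where
  h  = H n
  h₂ = H⁽²⁾ n
  r  = 1/suc n

-- Convolutions with harmonic numbers

harmonic-stirling : ∀ m n →
  (∑[ k ∈ 1 ⋯ n ] (H k * (∑[ j ∈ suc m ⋯ suc (n ∸ k) ] (fromℕ ((n ∸ k) C (j ∸ 1)) * (s j (suc m) * 1/ j !)))))
    ≡ 1/ suc m ! * H[ suc n , suc (suc m) ]
harmonic-stirling m n = begin
  ∑ (1 ⋯ n) _                                                       ≡⟨ ∑-⋯ 1 n _ ⟩
  ∑< n _                                                            ≡⟨ ∑<-cong n (λ i → trans (cong (H (suc i) *_) (stirling-sum m (n ∸ suc i))) (sym (*-assoc (H (suc i)) _ d))) ⟩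
  ∑< n (λ i → H (suc i) * (L ^ˢ suc m) (suc (n ∸ suc i)) * d)       ≡⟨ ∑<-*ʳ n _ d ⟩
  -- The missing terms k = 0 and k = n+1 are zero because `H 0` and the constant term of a positive
  -- power of `L` vanish.
  ∑< n (λ i → H (suc i) * (L ^ˢ suc m) (suc (n ∸ suc i))) * d       ≡⟨ cong (_* d) (sym (⊛-interior H (L ^ˢ suc m) n refl (^ˢ-zero L m refl))) ⟩
  (H ⊛ (L ^ˢ suc m)) (suc n) * d                                    ≡⟨ cong (_* d) (sym (H[,]-convolution (suc n) (suc m))) ⟩
  H[ suc n , suc (suc m) ] * d                                      ≡⟨ *-comm _ d ⟩
  d * H[ suc n , suc (suc m) ]                                      ∎
  where d = 1/ suc m !

-- The sum is the coefficient of xⁿ⁺¹ in (L/(1-x)) L. Moving 1/(1-x) onto the whole product makes it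
-- a partial sum of the coefficients of L².
harmonic-convolution : ∀ n → (∑[ k ∈ 1 ⋯ n ] (H k * (+ 1 / suc (n ∸ k)))) ≡ H (suc n) * H (suc n) - H⁽²⁾ (suc n)
harmonic-convolution n = begin
  ∑ (1 ⋯ n) _                                      ≡⟨ ∑-⋯ 1 n _ ⟩
  ∑< n (λ i → H (suc i) * L (suc (n ∸ suc i)))     ≡⟨ sym (⊛-interior H L n refl refl) ⟩
  (H ⊛ L) (suc n)                                  ≡⟨ ⊛-cong {g = L} (λ i → sym (partialSums-L i)) (λ _ → refl) (suc n) ⟩
  (partialSums L ⊛ L) (suc n)                      ≡⟨ sym (partialSums-⊛ˡ L L (suc n)) ⟩
  partialSums (L ⊛ L) (suc n)                      ≡⟨ partialSums-L⊛L (suc n) ⟩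
  H (suc n) * H (suc n) - H⁽²⁾ (suc n)             ∎

theorem7 : (∀ (m n : ℕ) → 1 ≤ m → 1 ≤ n →
    (∑[ k ∈ 1 ⋯ n ] (H k * (∑[ j ∈ m ⋯ suc (n ∸ k) ] (fromℕ ((n ∸ k) C (j ∸ 1)) * (s j m * 1/ j !)))))
    ≡ 1/ m ! * H[ suc n , suc m ])
    ×
    (∀ (n : ℕ) → 1 ≤ n →
    (∑[ k ∈ 1 ⋯ n ] (H k * (+ 1 / suc (n ∸ k))))
    ≡ H (suc n) * H (suc n) - H⁽²⁾ (suc n))
theorem7 = (λ { (suc m) n _ _ → harmonic-stirling m n }) , (λ n _ → harmonic-convolution n)
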